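{- Let $q$ be a prime power, $n=tt'$ with $t,t'\in\mathbb{N}$, and let $s,s'\in\mathbb{N}$ with $\gcd(s,t)=\gcd(s',t)=1$. Let $f(x)=\sum_{i=0}^{t'-1}a_ix^{q^{it+s}}$ and $g(x)=\sum_{i=0}^{t'-1}b_ix^{q^{it+s'}}$ in $\mathbb{F}_{q^n}[x]$ be R-$q^t$-partially scattered. Then $f(x)$ and $g(x)$ are weakly equivalent if and only if $s\equiv\pm s'\pmod t$.
   Context: An $\mathbb{F}_q$-linearized polynomial $f(x)\in\mathbb{F}_{q^n}[x]$ is R-$q^t$-partially scattered if for all $y,z\in\mathbb{F}_{q^n}^*$, $f(y)/y=f(z)/z$ and $y/z\in\mathbb{F}_{q^t}$ imply $y/z\in\mathbb{F}_q$. For such $f$ let $U_f=\{(x,f(x)):x\in\mathbb{F}_{q^n}\}\subseteq\mathbb{F}_{q^n}\times\mathbb{F}_{q^n}$. Regard $\mathbb{F}_{q^n}\times\mathbb{F}_{q^n}$ as a $2t'$-dimensional $\mathbb{F}_{q^t}$-vector space. Two $\mathbb{F}_q$-linearized polynomials $f,g$ are weakly equivalent if there exists $\varphi\in\Gamma\mathrm{L}(2t',q^t)$ (an invertible $\mathbb{F}_{q^t}$-semilinear map of this space) with $\varphi(U_f)=U_g$. -}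

module Defs where

open import Level using (Level; _⊔_)
open import Algebra.Bundles using (CommutativeRing)
open import Data.Nat as ℕ using (ℕ; zero; suc; _≤_)
open import Data.Nat.Primality using (Prime)
open import Data.Fin using (Fin; toℕ)
open import Data.Product using (Σ; ∃; ∃-syntax; _×_; _,_)
open import Relation.Nullary using (¬_)
open import Relation.Binary.PropositionalEquality using (_≡_)
import Relation.Binary.PropositionalEquality as ≡
open import Function.Bundles using (Inverse)

IsPrimePower : ℕ → Set
IsPrimePower q = ∃[ p ] ∃[ k ] (Prime p × 1 ≤ k × q ≡ p ℕ.^ k)

module FF {c ℓ : Level} (R : CommutativeRing c ℓ) where
  open CommutativeRing R

  IsField : Set (c ⊔ ℓ)
  IsField = (¬ (1# ≈ 0#)) × (∀ x → ¬ (x ≈ 0#) → ∃[ y ] (x * y ≈ 1#))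

  HasCard : ℕ → Set (c ⊔ ℓ)
  HasCard m = Inverse setoid (≡.setoid (Fin m))

  pow : Carrier → ℕ → Carrier
  pow x zero = 1#
  pow x (suc k) = x * pow x k

  -- membership in the subfield F_{q^k} = { x | x^(q^k) = x }
  InSub : ℕ → ℕ → Carrier → Set ℓ
  InSub q k x = pow x (q ℕ.^ k) ≈ x

  sumFin : (m : ℕ) → (Fin m → Carrier) → Carrier
  sumFin zero h = 0#
  sumFin (suc m) h = h Fin.zero + sumFin m (λ i → h (Fin.suc i))
    where import Data.Fin as Fin

  linPoly : (q t t' s : ℕ) → (Fin t' → Carrier) → Carrier → Carrier
  linPoly q t t' s a x = sumFin t' (λ i → a i * pow x (q ℕ.^ (toℕ i ℕ.* t ℕ.+ s)))

  -- R-q^t-partially scattered: for y,z ≠ 0, f(y)/y = f(z)/z and y/z ∈ F_{q^t}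
  -- imply y/z ∈ F_q.  (f(y)/y = f(z)/z written as f(y) z = f(z) y; y/z is the
  -- unique w with y = w z.)
  PartiallyScattered : (q t : ℕ) → (Carrier → Carrier) → Set (c ⊔ ℓ)
  PartiallyScattered q t f =
    ∀ y z → ¬ (y ≈ 0#) → ¬ (z ≈ 0#) → f y * z ≈ f z * y →
    (∃[ w ] (y ≈ w * z × InSub q t w)) → ∃[ w ] (y ≈ w * z × InSub q 1 w)

  IsSubAut : (q t : ℕ) → (Carrier → Carrier) → Set (c ⊔ ℓ)
  IsSubAut q t σ =
    (∀ x y → x ≈ y → σ x ≈ σ y) ×
    (∀ x → InSub q t x → InSub q t (σ x)) ×
    (∀ x y → InSub q t x → InSub q t y → σ (x + y) ≈ σ x + σ y) ×
    (∀ x y → InSub q t x → InSub q t y → σ (x * y) ≈ σ x * σ y) ×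
    (σ 1# ≈ 1#) ×
    (∀ x y → InSub q t x → InSub q t y → σ x ≈ σ y → x ≈ y) ×
    (∀ y → InSub q t y → ∃[ x ] (InSub q t x × σ x ≈ y))

  Pair : Set c
  Pair = Carrier × Carrier

  _≈P_ : Pair → Pair → Set ℓ
  (x₁ , x₂) ≈P (y₁ , y₂) = (x₁ ≈ y₁) × (x₂ ≈ y₂)

  _+P_ : Pair → Pair → Pair
  (x₁ , x₂) +P (y₁ , y₂) = (x₁ + y₁ , x₂ + y₂)

  _·P_ : Carrier → Pair → Pair
  λ' ·P (x₁ , x₂) = (λ' * x₁ , λ' * x₂)

  -- φ ∈ ΓL(2t', q^t): invertible F_{q^t}-semilinear map of F_{q^n} × F_{q^n}
  IsGammaL : (q t : ℕ) → (Pair → Pair) → Set (c ⊔ ℓ)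
  IsGammaL q t φ =
    (∀ u v → u ≈P v → φ u ≈P φ v) ×
    (∀ u v → φ (u +P v) ≈P (φ u +P φ v)) ×
    (∃[ σ ] (IsSubAut q t σ ×
             (∀ λ' u → InSub q t λ' → φ (λ' ·P u) ≈P (σ λ' ·P φ u)))) ×
    (∀ u v → φ u ≈P φ v → u ≈P v) ×
    (∀ v → ∃[ u ] (φ u ≈P v))

  InGraph : (Carrier → Carrier) → Pair → Set (c ⊔ ℓ)
  InGraph f v = ∃[ x ] (v ≈P (x , f x))

  WeaklyEquivalent : (q t : ℕ) → (Carrier → Carrier) → (Carrier → Carrier) → Set (c ⊔ ℓ)
  WeaklyEquivalent q t f g =
    ∃[ φ ] (IsGammaL q t φ ×
            (∀ v → InGraph f v → InGraph g (φ v)) ×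
            (∀ w → InGraph g w → ∃[ v ] (InGraph f v × φ v ≈P w)))

{-# OPTIONS --safe #-}
module Submission where

-- Let L = 𝔽_{qⁿ} and K = 𝔽_{qᵗ}. Both f and g are additive, with f(a x) = a^(q^s) f(x) and
-- g(a x) = a^(q^s') g(x) for a ∈ K; for t > 1 scatteredness makes them injective, hence bijective.
-- If s ≡ s' (mod t), the K-linear map (x , y) ↦ (x , g (f⁻¹ y)) carries U_f to U_g; if s ≡ −s', then
-- (x , y) ↦ (y , g (f x)) does; and if t = 1, then (x , y) ↦ (x , y − f x + g x) does.
-- Otherwise 0, s, s' and s + s' are distinct mod t, so the powers a ↦ a^(q^e) of these exponents
-- are linearly independent on K. Expanding φ(a x , f (a x)) ∈ U_g in powers of a then forces
-- φ(x , 0) = 0, which contradicts the injectivity of φ.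

open import Level using (_⊔_)
open import Algebra.Bundles using (CommutativeRing)
open import Data.Empty using (⊥-elim)
open import Data.Nat as ℕ using (ℕ; zero; suc; _≤_; _<_; z≤n; s≤s; s≤s⁻¹)
import Data.Nat.Properties as ℕ
open import Data.Nat.Primality using (Prime; euclidsLemma; prime⇒nonTrivial; prime⇒nonZero)
open import Data.Nat.Divisibility using (divides; ∣⇒≤; m∣m*n)
import Data.Nat.Divisibility as ℕ
open import Data.Nat.Combinatorics using (nCk≡n!/k![n-k]!; k![n∸k]!∣n!; nCn≡1) renaming (_C_ to _choose_)
open import Data.Nat.DivMod using (_%_; _/_; m/n*n≡m; m%n<n; m≡m%n+[m/n]*n; %-remove-+ʳ)
import Data.Integer as ℤ
import Data.Integer.Properties as ℤ
open import Data.Nat.GCD using (gcd-greatest)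
open import Data.List using (List; []; _∷_)
open import Data.List.Relation.Unary.All using (All; []; _∷_)
open import Data.Fin as Fin using (Fin; toℕ; fromℕ; inject₁)
import Data.Fin.Properties as Fin
open import Data.Fin.Permutation using (Permutation; permutation; _⟨$⟩ʳ_)
open import Data.Product using (∃-syntax; _×_; _,_; proj₁; proj₂)
open import Data.Sum using (_⊎_; inj₁; inj₂)
open import Function.Base using (_∘_)
open import Function.Bundles using (Inverse; mk⇔)
open import Relation.Nullary using (¬_; Dec; yes; no; contradiction)
open import Relation.Binary.Definitions using (tri<; tri≈; tri>)
open import Relation.Binary.PropositionalEquality as ≡ using (_≡_; _≢_)
open import Defs

-- The crux is the independence of the Frobenius powers on K. The obstacle is that only the order of
-- L is given: K is a predicate on L, so counting roots on K would first require |K|. Relations on K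
-- are therefore pulled back along the norm x ↦ x^G, G = (qⁿ - 1)/(qᵗ - 1), whose values lie in K.
-- The exponents G q^e with e < t are distinct and below qⁿ, so what results is an ordinary
-- polynomial of degree below |L| that vanishes on all of L, and counting roots in L suffices. The
-- same independence yields the injectivity of f and g: a nonzero kernel would force x^q = x on K, a
-- relation between the exponents 1 and 0, which differ mod t exactly when t > 1. For t = 1
-- scatteredness is vacuous and kernels may occur, but then f and g are themselves K-linear; this is
-- why that case is served by a shear, which is invertible in any event.

prime∤! : ∀ {p} → Prime p → ∀ k → k < p → ¬ (p ℕ.∣ k ℕ.!)
prime∤! {p} pr zero    k<p p∣ = ℕ.nonTrivial⇒≢1 {{prime⇒nonTrivial pr}} (ℕ.∣1⇒≡1 p∣)
prime∤! {p} pr (suc k) k<p p∣ with euclidsLemma (suc k) (k ℕ.!) pr p∣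
... | inj₁ p∣k  = ℕ.<⇒≱ k<p (∣⇒≤ p∣k)
... | inj₂ p∣k! = prime∤! pr k (ℕ.<-trans (ℕ.n<1+n k) k<p) p∣k!

-- `p` divides p! = C(p,k) k! (p - k)!, and it cannot divide either factorial on the right because
-- both are products of numbers below `p`.
prime∣C : ∀ {p k} → Prime p → 0 < k → k < p → p ℕ.∣ (p choose k)
prime∣C {p} {k} pr 0<k k<p
  with euclidsLemma (p choose k) (k ℕ.! ℕ.* (p ℕ.∸ k) ℕ.!) pr p∣product
  where
  instance
    nz = k ℕ.!* (p ℕ.∸ k) !≢0
  product≡p! : (p choose k) ℕ.* (k ℕ.! ℕ.* (p ℕ.∸ k) ℕ.!) ≡ p ℕ.!
  product≡p! = ≡.trans
    (≡.cong (ℕ._* (k ℕ.! ℕ.* (p ℕ.∸ k) ℕ.!)) (nCk≡n!/k![n-k]! (ℕ.<⇒≤ k<p)))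
    (m/n*n≡m (k![n∸k]!∣n! (ℕ.<⇒≤ k<p)))
  p∣p! : ∀ {p} → 0 < p → p ℕ.∣ p ℕ.!
  p∣p! {suc p} _ = m∣m*n (p ℕ.!)
  p∣product : p ℕ.∣ (p choose k) ℕ.* (k ℕ.! ℕ.* (p ℕ.∸ k) ℕ.!)
  p∣product = ≡.subst (p ℕ.∣_) (≡.sym product≡p!) (p∣p! (ℕ.<-trans 0<k k<p))
... | inj₁ p∣C = p∣C
... | inj₂ p∣k![p-k]! with euclidsLemma (k ℕ.!) ((p ℕ.∸ k) ℕ.!) pr p∣k![p-k]!
... | inj₁ p∣k!     = contradiction p∣k! (prime∤! pr k k<p)
... | inj₂ p∣[p-k]! = contradiction p∣[p-k]!
  (prime∤! pr (p ℕ.∸ k) (ℕ.∸-monoʳ-< 0<k (ℕ.<⇒≤ k<p)))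

-- Powers in a commutative ring and additivity of the Frobenius map.

module Power {c ℓ} (R : CommutativeRing c ℓ) where
  open CommutativeRing R
  open FF R
  open import Algebra.Properties.Semiring.Exp semiring using (_^_)
  open import Algebra.Properties.Semiring.Mult semiring using (×-congʳ; ×-assoc-*; ×-homo-1; ×1-homo-*)
    renaming (_×_ to _·_)
  open import Algebra.Properties.Semiring.Sum semiring using (sum; sum-init-last; sum-cong-≋; sum-replicate-zero)
  open import Algebra.Properties.CommutativeSemiring.Binomial commutativeSemiring
    using (binomialTerm; theorem)
  open import Algebra.Solver.Ring.NaturalCoefficients.Default commutativeSemiring
  open import Relation.Binary.Reasoning.Setoid setoid

  pow≡^ : ∀ x k → pow x k ≡ x ^ k
  pow≡^ x zero    = ≡.refl
  pow≡^ x (suc k) = ≡.cong (x *_) (pow≡^ x k)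

  pow-cong : ∀ k {x y} → x ≈ y → pow x k ≈ pow y k
  pow-cong zero    x≈y = refl
  pow-cong (suc k) x≈y = *-cong x≈y (pow-cong k x≈y)

  pow-congʳ : ∀ x {k l} → k ≡ l → pow x k ≈ pow x l
  pow-congʳ x ≡.refl = refl

  pow-+ : ∀ x k l → pow x (k ℕ.+ l) ≈ pow x k * pow x l
  pow-+ x zero    l = sym (*-identityˡ _)
  pow-+ x (suc k) l = trans (*-congˡ (pow-+ x k l)) (sym (*-assoc _ _ _))

  pow-* : ∀ x k l → pow x (k ℕ.* l) ≈ pow (pow x l) k
  pow-* x zero    l = refl
  pow-* x (suc k) l = trans (pow-+ x l (k ℕ.* l)) (*-congˡ (pow-* x k l))

  pow-distrib : ∀ k x y → pow (x * y) k ≈ pow x k * pow y k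
  pow-distrib zero    x y = sym (*-identityˡ _)
  pow-distrib (suc k) x y = trans (*-congˡ (pow-distrib k x y))
    (solve 4 (λ a b c d → (a :* b) :* (c :* d) := (a :* c) :* (b :* d)) refl x y (pow x k) (pow y k))

  pow-1# : ∀ k → pow 1# k ≈ 1#
  pow-1# zero    = refl
  pow-1# (suc k) = trans (*-identityˡ _) (pow-1# k)

  pow-0# : ∀ k → 0 < k → pow 0# k ≈ 0#
  pow-0# (suc k) _ = zeroˡ _

  HasChar : ℕ → Set ℓ
  HasChar p = p · 1# ≈ 0#

  char-multiple : ∀ {p m} → HasChar p → p ℕ.∣ m → ∀ x → m · x ≈ 0#
  char-multiple {p} char (divides d ≡.refl) x = begin
    (d ℕ.* p) · x        ≈⟨ ×-congʳ (d ℕ.* p) (*-identityˡ x) ⟨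
    (d ℕ.* p) · (1# * x) ≈⟨ ×-assoc-* (d ℕ.* p) 1# x ⟨
    ((d ℕ.* p) · 1#) * x ≈⟨ *-congʳ (×1-homo-* d p) ⟩
    ((d · 1#) * (p · 1#)) * x ≈⟨ *-congʳ (*-congˡ char) ⟩
    ((d · 1#) * 0#) * x ≈⟨ *-congʳ (zeroʳ _) ⟩
    0# * x              ≈⟨ zeroˡ x ⟩
    0# ∎

  -- All inner binomial coefficients are multiples of the characteristic, so only the two ends of
  -- the binomial expansion survive; the sum is split accordingly into first, middle and last terms.
  frobenius-+ : ∀ {p} → Prime p → HasChar p → ∀ x y → pow (x + y) p ≈ pow x p + pow y p
  frobenius-+ {zero} pr _ = contradiction ≡.refl (ℕ.≢-nonZero⁻¹ 0 {{prime⇒nonZero pr}})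
  frobenius-+ {p@(suc p-1)} pr char x y = begin
    pow (x + y) p                 ≡⟨ pow≡^ (x + y) p ⟩
    (x + y) ^ p                   ≈⟨ theorem p x y ⟩
    term Fin.zero + sum (term ∘ Fin.suc)
      ≈⟨ +-cong first (sum-init-last (term ∘ Fin.suc)) ⟩
    y ^ p + (sum (λ i → term (Fin.suc (inject₁ i))) + term (Fin.suc (fromℕ p-1)))
      ≈⟨ +-congˡ (+-cong (trans (sum-cong-≋ middle) (sum-replicate-zero p-1)) last) ⟩
    y ^ p + (0# + x ^ p)          ≈⟨ solve 2 (λ a b → a :+ (con 0 :+ b) := b :+ a) refl _ _ ⟩
    x ^ p + y ^ p                 ≡⟨ ≡.cong₂ _+_ (pow≡^ x p) (pow≡^ y p) ⟨
    pow x p + pow y p             ∎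
    where
    term = binomialTerm x y p
    first : term Fin.zero ≈ y ^ p
    first = trans (×-homo-1 _) (*-identityˡ _)
    last : term (Fin.suc (fromℕ p-1)) ≈ x ^ p
    last rewrite Fin.toℕ-fromℕ p-1 | nCn≡1 p | ℕ.n∸n≡0 p-1 =
      trans (×-homo-1 _) (*-identityʳ _)
    middle : ∀ i → term (Fin.suc (inject₁ i)) ≈ 0#
    middle i = char-multiple char
      (prime∣C pr (s≤s z≤n) (s≤s (≡.subst (_< p-1) (≡.sym (Fin.toℕ-inject₁ i)) (Fin.toℕ<n i)))) _

  frobenius^-+ : ∀ {p} → Prime p → HasChar p →
                 ∀ j x y → pow (x + y) (p ℕ.^ j) ≈ pow x (p ℕ.^ j) + pow y (p ℕ.^ j)
  frobenius^-+ pr char zero x y = solve 2 (λ a b → (a :+ b) :* con 1 := a :* con 1 :+ b :* con 1) refl x y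
  frobenius^-+ {p} pr char (suc j) x y = begin
    pow (x + y) (p ℕ.* p ℕ.^ j)       ≈⟨ pow-* (x + y) p (p ℕ.^ j) ⟩
    pow (pow (x + y) (p ℕ.^ j)) p     ≈⟨ pow-cong p (frobenius^-+ pr char j x y) ⟩
    pow (pow x (p ℕ.^ j) + pow y (p ℕ.^ j)) p ≈⟨ frobenius-+ pr char _ _ ⟩
    pow (pow x (p ℕ.^ j)) p + pow (pow y (p ℕ.^ j)) p ≈⟨ +-cong (pow-* x p (p ℕ.^ j)) (pow-* y p (p ℕ.^ j)) ⟨
    pow x (p ℕ.* p ℕ.^ j) + pow y (p ℕ.* p ℕ.^ j) ∎

-- Polynomials as coefficient sequences, and counting their roots.

module Polynomial {c ℓ} (R : CommutativeRing c ℓ) where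
  open CommutativeRing R
  open FF R
  open import Algebra.Solver.Ring.NaturalCoefficients.Default commutativeSemiring
  open import Relation.Binary.Reasoning.Setoid setoid

  -- A polynomial of degree < m is the restriction to k < m of a coefficient sequence.
  eval : ℕ → (ℕ → Carrier) → Carrier → Carrier
  eval zero    a x = 0#
  eval (suc m) a x = a 0 + x * eval m (a ∘ suc) x

  -- Synthetic division: for a of degree at most m these are the coefficients of (a(x) - a(r)) / (x
  -- - r), the k-th being a_(k+1) + a_(k+2) r + ... .
  quotient : ℕ → (ℕ → Carrier) → Carrier → ℕ → Carrier
  quotient zero    a r k       = 0#
  quotient (suc m) a r zero    = eval (suc m) (a ∘ suc) r
  quotient (suc m) a r (suc k) = quotient m (a ∘ suc) r k

  -- a(x) = a(r) + (x − r) b(x), with both sides moved so that it becomes a semiring identity.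
  eval-quotient : ∀ m a r x →
    eval (suc m) a x + r * eval m (quotient m a r) x ≈ eval (suc m) a r + x * eval m (quotient m a r) x
  eval-quotient zero    a r x = solve 3 (λ a r x →
    (a :+ x :* con 0) :+ r :* con 0 := (a :+ r :* con 0) :+ x :* con 0) refl (a 0) r x
  eval-quotient (suc m) a r x = begin
    (a₀ + x * ax) + r * (ar + x * b)
      ≈⟨ solve 6 (λ a₀ x ax r ar b → (a₀ :+ x :* ax) :+ r :* (ar :+ x :* b)
           := (a₀ :+ r :* ar) :+ x :* (ax :+ r :* b)) refl a₀ x ax r ar b ⟩
    (a₀ + r * ar) + x * (ax + r * b)
      ≈⟨ +-congˡ (*-congˡ (eval-quotient m (a ∘ suc) r x)) ⟩
    (a₀ + r * ar) + x * (ar + x * b) ∎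
    where
    a₀ = a 0
    ax = eval (suc m) (a ∘ suc) x
    ar = eval (suc m) (a ∘ suc) r
    b  = eval m (quotient m (a ∘ suc) r) x

  -- The lowest coefficient of the quotient is the value at `r` of the tail `a ∘ suc`. If it is
  -- zero, then `a 0` equals a(r) = 0, and the tail again has root `r` and zero quotient, so the
  -- argument repeats.
  quotient-zero : ∀ m a r → (∀ k → k < m → quotient m a r k ≈ 0#) → eval (suc m) a r ≈ 0# →
                  ∀ k → k < suc m → a k ≈ 0#
  quotient-zero zero a r _ ar≈0 zero _ =
    trans (solve 2 (λ a r → a := a :+ r :* con 0) refl (a 0) r) ar≈0
  quotient-zero zero a r _ ar≈0 (suc k) (s≤s ())
  quotient-zero (suc m) a r b≈0 ar≈0 zero _ = begin
    a 0                                     ≈⟨ solve 2 (λ a r → a := a :+ r :* con 0) refl (a 0) r ⟩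
    a 0 + r * 0#                            ≈⟨ +-congˡ (*-congˡ (b≈0 0 (s≤s z≤n))) ⟨
    a 0 + r * eval (suc m) (a ∘ suc) r      ≈⟨ ar≈0 ⟩
    0#                                      ∎
  quotient-zero (suc m) a r b≈0 ar≈0 (suc k) k<m = quotient-zero m (a ∘ suc) r
    (λ k k<m → b≈0 (suc k) (s≤s k<m)) (b≈0 0 (s≤s z≤n)) k (s≤s⁻¹ k<m)

  -- Dividing by x - `r₀` leaves a quotient that vanishes at all the other points, to which
  -- induction applies. The first hypothesis is the absence of zero divisors, with the difference x
  -- - y split over the two sides.
  vanishing-eval⇒zero :
    (∀ {x y z} → ¬ (x ≈ y) → x * z ≈ y * z → z ≈ 0#) →
    ∀ m a (r : Fin m → Carrier) → (∀ {i j} → r i ≈ r j → i ≡ j) →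
    (∀ i → eval m a (r i) ≈ 0#) → ∀ k → k < m → a k ≈ 0#
  vanishing-eval⇒zero cancel (suc m) a r r-inj ar≈0 =
    quotient-zero m a r₀
      (vanishing-eval⇒zero cancel m (quotient m a r₀) (r ∘ Fin.suc) (Fin.suc-injective ∘ r-inj) b≈0)
      (ar≈0 Fin.zero)
    where
    r₀ = r Fin.zero
    b≈0 : ∀ i → eval m (quotient m a r₀) (r (Fin.suc i)) ≈ 0#
    b≈0 i = cancel (Fin.0≢1+n ∘ r-inj) (begin
      r₀ * b                       ≈⟨ +-identityˡ _ ⟨
      0# + r₀ * b                  ≈⟨ +-congʳ (ar≈0 (Fin.suc i)) ⟨
      eval (suc m) a rᵢ + r₀ * b   ≈⟨ eval-quotient m a r₀ rᵢ ⟩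
      eval (suc m) a r₀ + rᵢ * b   ≈⟨ +-congʳ (ar≈0 Fin.zero) ⟩
      0# + rᵢ * b                  ≈⟨ +-identityˡ _ ⟩
      rᵢ * b                       ∎)
      where
      rᵢ = r (Fin.suc i)
      b  = eval m (quotient m a r₀) rᵢ

  eval-+ : ∀ m a b x → eval m (λ k → a k + b k) x ≈ eval m a x + eval m b x
  eval-+ zero    a b x = sym (+-identityˡ _)
  eval-+ (suc m) a b x = trans (+-congˡ (*-congˡ (eval-+ m (a ∘ suc) (b ∘ suc) x)))
    (solve 5 (λ a b x p q → (a :+ b) :+ x :* (p :+ q) := (a :+ x :* p) :+ (b :+ x :* q)) refl _ _ _ _ _)

  eval-0 : ∀ m x → eval m (λ _ → 0#) x ≈ 0#
  eval-0 zero    x = refl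
  eval-0 (suc m) x = trans (+-identityˡ _) (trans (*-congˡ (eval-0 m x)) (zeroʳ x))

  monomial : ℕ → Carrier → ℕ → Carrier
  monomial zero    c zero    = c
  monomial zero    c (suc k) = 0#
  monomial (suc e) c zero    = 0#
  monomial (suc e) c (suc k) = monomial e c k

  monomial-diag : ∀ e c → monomial e c e ≡ c
  monomial-diag zero    c = ≡.refl
  monomial-diag (suc e) c = monomial-diag e c

  monomial-off : ∀ {e k} c → e ≢ k → monomial e c k ≡ 0#
  monomial-off {zero}  {zero}  c e≢k = contradiction ≡.refl e≢k
  monomial-off {zero}  {suc k} c e≢k = ≡.refl
  monomial-off {suc e} {zero}  c e≢k = ≡.refl
  monomial-off {suc e} {suc k} c e≢k = monomial-off c (e≢k ∘ ≡.cong suc)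

  -- Used with `h e` = G q^e, where G is the norm exponent: the coefficients of the pulled-back
  -- polynomial at these exponents are those of the original linearized polynomial.
  monomial-reindex : ∀ (h : ℕ → ℕ) → (∀ {i j} → h i ≡ h j → i ≡ j) →
                     ∀ e c k → monomial (h e) c (h k) ≡ monomial e c k
  monomial-reindex h h-inj e c k with e ℕ.≟ k
  ... | yes ≡.refl = ≡.trans (monomial-diag (h e) c) (≡.sym (monomial-diag e c))
  ... | no  e≢k    = ≡.trans (monomial-off c (e≢k ∘ h-inj)) (≡.sym (monomial-off c e≢k))

  eval-monomial : ∀ m e c x → e < m → eval m (monomial e c) x ≈ c * pow x e
  eval-monomial (suc m) zero    c x _ = begin
    c + x * eval m (λ _ → 0#) x ≈⟨ +-congˡ (*-congˡ (eval-0 m x)) ⟩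
    c + x * 0#                  ≈⟨ solve 2 (λ c x → c :+ x :* con 0 := c :* con 1) refl c x ⟩
    c * 1#                      ∎
  eval-monomial (suc m) (suc e) c x (s≤s e<m) = begin
    0# + x * eval m (monomial e c) x ≈⟨ +-congˡ (*-congˡ (eval-monomial m e c x e<m)) ⟩
    0# + x * (c * pow x e)           ≈⟨ solve 3 (λ x c p → con 0 :+ x :* (c :* p) := c :* (x :* p)) refl x c (pow x e) ⟩
    c * (x * pow x e)                ∎

-- Finite fields: characteristic, Fermat's theorem, pigeonhole principle.

module FiniteField {c ℓ} (R : CommutativeRing c ℓ) (isField : FF.IsField R)
                   {N : ℕ} (card : FF.HasCard R N) where
  open CommutativeRing R
  open FF R
  open Power R
  open Polynomial R
  open Inverse card using (to; from; to-cong; from-cong; strictlyInverseˡ; strictlyInverseʳ)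
  open import Algebra.Properties.Ring ring using (+-cancelˡ)
  open import Algebra.Properties.Semiring.Mult semiring using ()
    renaming (_×_ to _·_)
  open import Algebra.Properties.Semiring.Sum semiring
    using (sum; sum-permute; sum-cong-≋; ∑-distrib-+; sum-replicate)
  open import Algebra.Properties.CommutativeMonoid.Sum *-commutativeMonoid using ()
    renaming (sum to product; sum-permute to product-permute; sum-cong-≋ to product-cong;
              ∑-distrib-+ to product-distrib; sum-remove to product-remove; sum-replicate to product-replicate)
  open import Relation.Binary.Reasoning.Setoid setoid

  1≉0 : ¬ (1# ≈ 0#)
  1≉0 = proj₁ isField

  infix 4 _≈?_
  _≈?_ : ∀ x y → Dec (x ≈ y)
  x ≈? y with to x Fin.≟ to y
  ... | yes eq = yes (trans (sym (strictlyInverseʳ x)) (trans (from-cong eq) (strictlyInverseʳ y)))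
  ... | no neq = no (neq ∘ to-cong)

  from-injective : ∀ {i j} → from i ≈ from j → i ≡ j
  from-injective {i} {j} eq = ≡.trans (≡.sym (strictlyInverseˡ i)) (≡.trans (to-cong eq) (strictlyInverseˡ j))

  *-cancel : ∀ {x y z} → ¬ (x ≈ 0#) → x * y ≈ x * z → y ≈ z
  *-cancel {x} {y} {z} x≉0 eq with x⁻¹ , xx⁻¹≈1 ← proj₂ isField x x≉0 = begin
    y              ≈⟨ unit y ⟨
    x⁻¹ * (x * y)  ≈⟨ *-congˡ eq ⟩
    x⁻¹ * (x * z)  ≈⟨ unit z ⟩
    z              ∎
    where
    unit : ∀ w → x⁻¹ * (x * w) ≈ w
    unit w = trans (sym (*-assoc _ _ _))
      (trans (*-congʳ (trans (*-comm _ _) xx⁻¹≈1)) (*-identityˡ w))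

  *-nonzero : ∀ {x y} → ¬ (x ≈ 0#) → ¬ (y ≈ 0#) → ¬ (x * y ≈ 0#)
  *-nonzero x≉0 y≉0 xy≈0 = y≉0 (*-cancel x≉0 (trans xy≈0 (sym (zeroʳ _))))

  *-separates : ∀ {x y z} → ¬ (x ≈ y) → x * z ≈ y * z → z ≈ 0#
  *-separates {x} {y} {z} x≉y eq with z ≈? 0#
  ... | yes z≈0 = z≈0
  ... | no  z≉0 = contradiction (*-cancel z≉0 (trans (*-comm z x) (trans eq (*-comm y z)))) x≉y

  vanishing⇒zero : ∀ a → (∀ x → eval N a x ≈ 0#) → ∀ k → k < N → a k ≈ 0#
  vanishing⇒zero a a≈0 = vanishing-eval⇒zero *-separates N a from from-injective (a≈0 ∘ from)

  -- Transports a bijection of the field to its index set `Fin N`, where invariance of sums and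
  -- products under permutations is available.
  conjugate : (h h⁻¹ : Carrier → Carrier) → (∀ {x y} → x ≈ y → h x ≈ h y) →
              (∀ {x y} → x ≈ y → h⁻¹ x ≈ h⁻¹ y) →
              (∀ x → h (h⁻¹ x) ≈ x) → (∀ x → h⁻¹ (h x) ≈ x) → Permutation N N
  conjugate h h⁻¹ h-cong h⁻¹-cong hh⁻¹ h⁻¹h = permutation (to ∘ h ∘ from) (to ∘ h⁻¹ ∘ from)
    (λ i → ≡.trans (to-cong (trans (h-cong (strictlyInverseʳ _)) (hh⁻¹ _))) (strictlyInverseˡ i))
    (λ i → ≡.trans (to-cong (trans (h⁻¹-cong (strictlyInverseʳ _)) (h⁻¹h _))) (strictlyInverseˡ i))

  -- The sum of all elements is invariant under the translation x ↦ x + 1.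
  order·1≈0 : N · 1# ≈ 0#
  order·1≈0 = +-cancelˡ (sum from) _ _ (begin
    sum from + N · 1#                ≈⟨ +-congˡ (sum-replicate N) ⟨
    sum from + sum (λ (_ : Fin N) → 1#) ≈⟨ ∑-distrib-+ from (λ _ → 1#) ⟨
    sum (λ i → from i + 1#)          ≈⟨ sum-cong-≋ (λ i → strictlyInverseʳ (from i + 1#)) ⟨
    sum (λ i → from (π ⟨$⟩ʳ i))      ≈⟨ sum-permute from π ⟨
    sum from                         ≈⟨ +-identityʳ _ ⟨
    sum from + 0#                    ∎)
    where
    π = conjugate (_+ 1#) (_+ - 1#) +-congʳ +-congʳ
      (λ x → trans (+-assoc _ _ _) (trans (+-congˡ (-‿inverseˡ 1#)) (+-identityʳ x)))
      (λ x → trans (+-assoc _ _ _) (trans (+-congˡ (-‿inverseʳ 1#)) (+-identityʳ x)))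

  product-nonzero : ∀ {m} (v : Fin m → Carrier) → (∀ i → ¬ (v i ≈ 0#)) → ¬ (product v ≈ 0#)
  product-nonzero {zero}  v v≉0 = 1≉0
  product-nonzero {suc m} v v≉0 = *-nonzero (v≉0 Fin.zero) (product-nonzero (v ∘ Fin.suc) (v≉0 ∘ Fin.suc))

  -- The extra factor `x` makes up for the single entry equal to 1. In `fermat` that entry sits at
  -- the index of 0.
  product-constant-except : ∀ {m} (v : Fin m → Carrier) x i₀ → v i₀ ≈ 1# → (∀ i → i ≢ i₀ → v i ≈ x) →
                            x * product v ≈ pow x m
  product-constant-except {suc m} v x i₀ v₀≈1 v≈x = *-congˡ (begin
    product v                                          ≈⟨ product-remove {i = i₀} v ⟩
    v i₀ * product (λ j → v (Fin.punchIn i₀ j))        ≈⟨ *-cong v₀≈1 (product-cong (λ j → v≈x _ (Fin.punchInᵢ≢i i₀ j))) ⟩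
    1# * product (λ (_ : Fin m) → x)                   ≈⟨ *-identityˡ _ ⟩
    product (λ (_ : Fin m) → x)                        ≈⟨ product-replicate m ⟩
    _                                                  ≡⟨ pow≡^ x m ⟨
    pow x m                                            ∎)

  -- Replacing 0 by 1 lets a product over the whole field stand for the product of the nonzero
  -- elements, without enumerating the unit group.
  unit-part : Carrier → Carrier
  unit-part z with z ≈? 0#
  ... | yes _ = 1#
  ... | no  _ = z

  unit-part-nonzero : ∀ z → ¬ (unit-part z ≈ 0#)
  unit-part-nonzero z with z ≈? 0#
  ... | yes _   = 1≉0
  ... | no  z≉0 = z≉0

  unit-part-cong : ∀ {y z} → y ≈ z → unit-part y ≈ unit-part z
  unit-part-cong {y} {z} y≈z with y ≈? 0# | z ≈? 0#
  ... | yes _   | yes _   = refl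
  ... | yes y≈0 | no  z≉0 = contradiction (trans (sym y≈z) y≈0) z≉0
  ... | no  y≉0 | yes z≈0 = contradiction (trans y≈z z≈0) y≉0
  ... | no  _   | no  _   = y≈z

  scaling : Carrier → Carrier → Carrier
  scaling x z with z ≈? 0#
  ... | yes _ = 1#
  ... | no  _ = x

  unit-part-* : ∀ {x} → ¬ (x ≈ 0#) → ∀ z → unit-part (x * z) ≈ scaling x z * unit-part z
  unit-part-* {x} x≉0 z with z ≈? 0# | x * z ≈? 0#
  ... | yes _   | yes _    = sym (*-identityˡ 1#)
  ... | yes z≈0 | no  xz≉0 = contradiction (trans (*-congˡ z≈0) (zeroʳ x)) xz≉0
  ... | no  z≉0 | yes xz≈0 = contradiction xz≈0 (*-nonzero x≉0 z≉0)
  ... | no  _   | no  _    = refl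

  scaling-0 : ∀ x {z} → z ≈ 0# → scaling x z ≈ 1#
  scaling-0 x {z} z≈0 with z ≈? 0#
  ... | yes _   = refl
  ... | no  z≉0 = contradiction z≈0 z≉0

  scaling-nonzero : ∀ x {z} → ¬ (z ≈ 0#) → scaling x z ≈ x
  scaling-nonzero x {z} z≉0 with z ≈? 0#
  ... | yes z≈0 = contradiction z≈0 z≉0
  ... | no  _   = refl

  order>0 : 0 < N
  order>0 = ℕ.≤-trans (s≤s z≤n) (Fin.toℕ<n (to 0#))

  -- For x ≠ 0 the product of all nonzero elements is invariant under multiplication by x.
  fermat : ∀ x → pow x N ≈ x
  fermat x with x ≈? 0#
  ... | yes x≈0 = trans (pow-cong N x≈0) (trans (pow-0# N order>0) (sym x≈0))
  ... | no  x≉0 with x⁻¹ , xx⁻¹≈1 ← proj₂ isField x x≉0 = begin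
    pow x N                              ≈⟨ product-constant-except (scaling x ∘ from) x (to 0#)
                                              (scaling-0 x (strictlyInverseʳ 0#))
                                              (λ i i≢0 → scaling-nonzero x (i≢0 ∘ λ i≈0 →
                                                 ≡.trans (≡.sym (strictlyInverseˡ i)) (to-cong i≈0))) ⟨
    x * product (scaling x ∘ from)       ≈⟨ *-congˡ (*-cancel P≉0 P*scaling≈P*1) ⟩
    x * 1#                               ≈⟨ *-identityʳ x ⟩
    x                                    ∎
    where
    P = product (unit-part ∘ from)
    P≉0 : ¬ (P ≈ 0#)
    P≉0 = product-nonzero (unit-part ∘ from) (unit-part-nonzero ∘ from)
    π = conjugate (x *_) (x⁻¹ *_) *-congˡ *-congˡ
      (λ z → trans (sym (*-assoc _ _ _)) (trans (*-congʳ xx⁻¹≈1) (*-identityˡ z)))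
      (λ z → trans (sym (*-assoc _ _ _)) (trans (*-congʳ (trans (*-comm _ _) xx⁻¹≈1)) (*-identityˡ z)))
    P*scaling≈P*1 : P * product (scaling x ∘ from) ≈ P * 1#
    P*scaling≈P*1 = begin
      P * product (scaling x ∘ from)                     ≈⟨ *-comm _ _ ⟩
      product (scaling x ∘ from) * P                     ≈⟨ product-distrib (scaling x ∘ from) (unit-part ∘ from) ⟨
      product (λ i → scaling x (from i) * unit-part (from i)) ≈⟨ product-cong (unit-part-* x≉0 ∘ from) ⟨
      product (λ i → unit-part (x * from i))             ≈⟨ product-cong (λ i → unit-part-cong (strictlyInverseʳ (x * from i))) ⟨
      product (λ i → unit-part (from (π ⟨$⟩ʳ i)))        ≈⟨ product-permute (unit-part ∘ from) π ⟨
      P                                                  ≈⟨ *-identityʳ P ⟨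
      P * 1#                                             ∎

  -- If `y` were missed, then `y` and the N values of `f` would be N + 1 distinct elements of a
  -- field of order N.
  injective⇒surjective : (f : Carrier → Carrier) → (∀ {x y} → f x ≈ f y → x ≈ y) →
                         ∀ y → ∃[ x ] (f x ≈ y)
  injective⇒surjective f f-inj y with Fin.any? (λ i → f (from i) ≈? y)
  ... | yes (i , fi≈y) = from i , fi≈y
  ... | no  y∉f        = ⊥-elim (ℕ.1+n≰n (Fin.injective⇒≤ {f = g} g-inj))
    where
    g : Fin (suc N) → Fin N
    g Fin.zero    = to y
    g (Fin.suc i) = to (f (from i))
    to-injective : ∀ {x z} → to x ≡ to z → x ≈ z
    to-injective {x} {z} eq = trans (sym (strictlyInverseʳ x)) (trans (from-cong eq) (strictlyInverseʳ z))
    g-inj : ∀ {i j} → g i ≡ g j → i ≡ j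
    g-inj {Fin.zero}  {Fin.zero}  eq = ≡.refl
    g-inj {Fin.zero}  {Fin.suc j} eq = contradiction (j , sym (to-injective eq)) y∉f
    g-inj {Fin.suc i} {Fin.zero}  eq = contradiction (i , to-injective eq) y∉f
    g-inj {Fin.suc i} {Fin.suc j} eq = ≡.cong Fin.suc (from-injective (f-inj (to-injective eq)))

  pow≈0⇒≈0 : ∀ x k → pow x k ≈ 0# → x ≈ 0#
  pow≈0⇒≈0 x k xᵏ≈0 with x ≈? 0#
  ... | yes x≈0 = x≈0
  ... | no  x≉0 = contradiction xᵏ≈0 (pow-nonzero k)
    where
    pow-nonzero : ∀ k → ¬ (pow x k ≈ 0#)
    pow-nonzero zero    = 1≉0
    pow-nonzero (suc k) = *-nonzero x≉0 (pow-nonzero k)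

  -- 0 = N · 1 = (p · 1)^j, and a field has no nonzero nilpotent elements.
  order≡p^j⇒HasChar : ∀ p j → N ≡ p ℕ.^ j → HasChar p
  order≡p^j⇒HasChar p j N≡pʲ = pow≈0⇒≈0 _ j (trans (sym (·-^ j)) (trans (·-congˡ (≡.sym N≡pʲ)) order·1≈0))
    where
    open import Algebra.Properties.Semiring.Mult semiring
      using (×1-homo-*; ×-homo-1) renaming (×-congˡ to ·-congˡ)
    ·-^ : ∀ j → (p ℕ.^ j) · 1# ≈ pow (p · 1#) j
    ·-^ zero    = ×-homo-1 1#
    ·-^ (suc j) = trans (×1-homo-* p (p ℕ.^ j)) (*-congˡ (·-^ j))

-- Congruences modulo t.

-- Integer divisibility unfolds to divisibility of absolute values, so this moves the condition on s
-- - s' to the naturals; for s + s' the translation holds by computation.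
∣+m-+n∣≡∣m-n∣ : ∀ m n → ℤ.∣ ℤ.+ m ℤ.- ℤ.+ n ∣ ≡ ℕ.∣ m - n ∣
∣+m-+n∣≡∣m-n∣ m n with ℕ.≤-total m n
... | inj₁ m≤n = ≡.trans (≡.cong ℤ.∣_∣ (ℤ.m-n≡m⊖n m n))
  (≡.trans (ℤ.∣⊖∣-≤ m≤n) (≡.sym (ℕ.m≤n⇒∣m-n∣≡n∸m m≤n)))
... | inj₂ n≤m = ≡.trans (≡.cong ℤ.∣_∣ (ℤ.m-n≡m⊖n m n))
  (≡.trans (ℤ.∣m⊖n∣≡∣n⊖m∣ m n) (≡.trans (ℤ.∣⊖∣-≤ n≤m) (≡.sym (ℕ.m≤n⇒∣n-m∣≡n∸m n≤m))))

%-≡⇒∣∣-∣ : ∀ t .{{_ : ℕ.NonZero t}} m n → m % t ≡ n % t → t ℕ.∣ ℕ.∣ m - n ∣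
%-≡⇒∣∣-∣ t m n eq = divides ℕ.∣ m / t - n / t ∣ (begin
  ℕ.∣ m - n ∣                                              ≡⟨ ≡.cong₂ ℕ.∣_-_∣ (m≡m%n+[m/n]*n m t) (m≡m%n+[m/n]*n n t) ⟩
  ℕ.∣ m % t ℕ.+ m / t ℕ.* t - n % t ℕ.+ n / t ℕ.* t ∣      ≡⟨ ≡.cong (λ r → ℕ.∣ r ℕ.+ m / t ℕ.* t - n % t ℕ.+ n / t ℕ.* t ∣) eq ⟩
  ℕ.∣ n % t ℕ.+ m / t ℕ.* t - n % t ℕ.+ n / t ℕ.* t ∣      ≡⟨ ℕ.∣m+n-m+o∣≡∣n-o∣ (n % t) _ _ ⟩
  ℕ.∣ m / t ℕ.* t - n / t ℕ.* t ∣                          ≡⟨ ℕ.*-distribʳ-∣-∣ t (m / t) (n / t) ⟨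
  ℕ.∣ m / t - n / t ∣ ℕ.* t                                ∎)
  where open ≡.≡-Reasoning

∣∣-∣⇒%-≡ : ∀ t .{{_ : ℕ.NonZero t}} m n → t ℕ.∣ ℕ.∣ m - n ∣ → m % t ≡ n % t
∣∣-∣⇒%-≡ t m n t∣ with ℕ.≤-total m n
... | inj₁ m≤n = ≡.trans (≡.sym (%-remove-+ʳ m (≡.subst (t ℕ.∣_) (ℕ.m≤n⇒∣m-n∣≡n∸m m≤n) t∣)))
  (≡.cong (_% t) (ℕ.m+[n∸m]≡n m≤n))
... | inj₂ n≤m = ≡.trans (≡.cong (_% t) (≡.sym (ℕ.m+[n∸m]≡n n≤m)))
  (%-remove-+ʳ n (≡.subst (t ℕ.∣_) (ℕ.m≤n⇒∣n-m∣≡n∸m n≤m) t∣))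

primePower>1 : ∀ {q} → IsPrimePower q → 1 < q
primePower>1 (p , suc k , pr , _ , ≡.refl) = ℕ.<-≤-trans
  (ℕ.nonTrivial⇒n>1 p {{prime⇒nonTrivial pr}})
  (ℕ.m≤m*n p (p ℕ.^ k) {{ℕ.m^n≢0 p k {{prime⇒nonZero pr}}}})

-- Geometric sums, the exponents of norms.

-- The sum 1 + Q + ... + Q^(j-1) in Horner form. For Q = qᵗ and j = t' it is (qⁿ - 1)/(qᵗ - 1), the
-- exponent of the norm from L to K.
geometricSum : ℕ → ℕ → ℕ
geometricSum Q zero    = 0
geometricSum Q (suc j) = suc (geometricSum Q j ℕ.* Q)

-- Subtraction-free form of G (Q − 1) = Q^j − 1.
geometricSum-closed : ∀ Q j → geometricSum Q (suc j) ≡ geometricSum Q j ℕ.+ Q ℕ.^ j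
geometricSum-closed Q zero    = ≡.refl
geometricSum-closed Q (suc j) = begin
  suc (geometricSum Q (suc j) ℕ.* Q)                   ≡⟨ ≡.cong (λ g → suc (g ℕ.* Q)) (geometricSum-closed Q j) ⟩
  suc ((geometricSum Q j ℕ.+ Q ℕ.^ j) ℕ.* Q)           ≡⟨ ≡.cong suc (ℕ.*-distribʳ-+ Q (geometricSum Q j) (Q ℕ.^ j)) ⟩
  suc (geometricSum Q j ℕ.* Q ℕ.+ Q ℕ.^ j ℕ.* Q)       ≡⟨ ≡.cong (geometricSum Q (suc j) ℕ.+_) (ℕ.*-comm (Q ℕ.^ j) Q) ⟩
  geometricSum Q (suc j) ℕ.+ Q ℕ.* Q ℕ.^ j             ∎
  where open ≡.≡-Reasoning

-- With G the sum and Q = qᵗ, doubling G q^e stays within G q^(e+1) ≤ G Q < G + Q^j ≤ G q^e + Q^j,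
-- and one copy of G q^e cancels. The bound keeps the pulled-back polynomials below degree |L|.
geometricSum-bound : ∀ {q e t} j → 1 < q → e < t → geometricSum (q ℕ.^ t) j ℕ.* q ℕ.^ e < (q ℕ.^ t) ℕ.^ j
geometricSum-bound {q} {e} {t} j 1<q e<t = ℕ.+-cancelˡ-< a a ((q ℕ.^ t) ℕ.^ j) (begin-strict
  a ℕ.+ a                      ≡⟨ ≡.cong (a ℕ.+_) (ℕ.+-identityʳ a) ⟨
  2 ℕ.* a                      ≤⟨ ℕ.*-monoˡ-≤ a 1<q ⟩
  q ℕ.* (G ℕ.* q ℕ.^ e)        ≡⟨ x∙yz≈y∙xz q G (q ℕ.^ e) ⟩
  G ℕ.* q ℕ.^ suc e            ≤⟨ ℕ.*-monoʳ-≤ G (ℕ.^-monoʳ-≤ q e<t) ⟩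
  G ℕ.* q ℕ.^ t                <⟨ ℕ.n<1+n _ ⟩
  suc (G ℕ.* q ℕ.^ t)          ≡⟨ geometricSum-closed (q ℕ.^ t) j ⟩
  G ℕ.+ (q ℕ.^ t) ℕ.^ j        ≤⟨ ℕ.+-monoˡ-≤ ((q ℕ.^ t) ℕ.^ j) (ℕ.m≤m*n G (q ℕ.^ e) {{ℕ.m^n≢0 q e}}) ⟩
  a ℕ.+ (q ℕ.^ t) ℕ.^ j        ∎)
  where
  G = geometricSum (q ℕ.^ t) j
  a = G ℕ.* q ℕ.^ e
  instance
    _ = ℕ.>-nonZero (ℕ.<-trans (s≤s z≤n) 1<q)
  open ℕ.≤-Reasoning
  open import Algebra.Properties.CommutativeSemigroup ℕ.*-commutativeSemigroup using (x∙yz≈y∙xz)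

-- Frobenius powers, the subfield K and the norm.

-- F k is the k-th power of the q-Frobenius of L = 𝔽_{qⁿ}; K = InSub q t is the subfield 𝔽_{qᵗ}.
module Frobenius {c ℓ} (R : CommutativeRing c ℓ) (isField : FF.IsField R)
                 {q n t t' : ℕ} (primePower : IsPrimePower q) (card : FF.HasCard R (q ℕ.^ n))
                 (n≡tt' : n ≡ t ℕ.* t') (1≤t : 1 ≤ t) (1≤t' : 1 ≤ t') where
  open CommutativeRing R
  open FF R
  open Power R
  open Polynomial R
  open FiniteField R isField card
  open import Algebra.Properties.Ring ring using (-‿distribˡ-*; -‿distribʳ-*; +-cancelˡ; +-cancelʳ; -‿+-comm)
  open import Algebra.Properties.Group +-group using (x∙y⁻¹≈ε⇒x≈y)
  open import Algebra.Solver.Ring.NaturalCoefficients.Default commutativeSemiring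
  open import Relation.Binary.Reasoning.Setoid setoid

  instance
    t-nonZero : ℕ.NonZero t
    t-nonZero = ℕ.>-nonZero 1≤t

    q-nonZero : ℕ.NonZero q
    q-nonZero = ℕ.>-nonZero (ℕ.<-trans (s≤s z≤n) (primePower>1 primePower))

  F : ℕ → Carrier → Carrier
  F k x = pow x (q ℕ.^ k)

  K : Carrier → Set ℓ
  K = InSub q t

  F-cong : ∀ k {x y} → x ≈ y → F k x ≈ F k y
  F-cong k = pow-cong (q ℕ.^ k)

  F-* : ∀ k x y → F k (x * y) ≈ F k x * F k y
  F-* k = pow-distrib (q ℕ.^ k)

  F-+ : ∀ k x y → F k (x + y) ≈ F k x + F k y
  F-+ k x y =
    -- Every power of q is a power of p; applied to the order qⁿ of L, the same rewriting shows that
    -- the characteristic is p.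
    ≡.subst (λ e → pow (x + y) e ≈ pow x e + pow y e) (≡.sym (q^≡p^ k))
      (frobenius^-+ pr (order≡p^j⇒HasChar p (a ℕ.* n) (q^≡p^ n)) (a ℕ.* k) x y)
    where
    p    = proj₁ primePower
    a    = proj₁ (proj₂ primePower)
    pr   = proj₁ (proj₂ (proj₂ primePower))
    q≡pᵃ = proj₂ (proj₂ (proj₂ (proj₂ primePower)))
    q^≡p^ : ∀ k → q ℕ.^ k ≡ p ℕ.^ (a ℕ.* k)
    q^≡p^ k = ≡.trans (≡.cong (ℕ._^ k) q≡pᵃ) (ℕ.^-*-assoc p a k)

  F-0 : ∀ x → F 0 x ≈ x
  F-0 = *-identityʳ

  F-∘ : ∀ j k x → F (j ℕ.+ k) x ≈ F j (F k x)
  F-∘ j k x = trans (pow-congʳ x (ℕ.^-distribˡ-+-* q j k)) (pow-* x (q ℕ.^ j) (q ℕ.^ k))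

  F-multiple : ∀ j {x} → K x → F (j ℕ.* t) x ≈ x
  F-multiple zero    x∈K = F-0 _
  F-multiple (suc j) x∈K = trans (F-∘ t (j ℕ.* t) _) (trans (F-cong t (F-multiple j x∈K)) x∈K)

  F-∣ : ∀ {k x} → t ℕ.∣ k → K x → F k x ≈ x
  F-∣ (divides j ≡.refl) = F-multiple j

  F-% : ∀ k {x} → K x → F k x ≈ F (k % t) x
  F-% k {x} x∈K = begin
    F k x                             ≡⟨ ≡.cong (λ k → F k x) (m≡m%n+[m/n]*n k t) ⟩
    F (k % t ℕ.+ k / t ℕ.* t) x       ≈⟨ F-∘ (k % t) (k / t ℕ.* t) x ⟩
    F (k % t) (F (k / t ℕ.* t) x)     ≈⟨ F-cong (k % t) (F-multiple (k / t) x∈K) ⟩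
    F (k % t) x                       ∎

  F-congruent : ∀ {k l x} → k % t ≡ l % t → K x → F k x ≈ F l x
  F-congruent {k} {l} {x} eq x∈K =
    trans (F-% k x∈K) (trans (reflexive (≡.cong (λ k → F k x) eq)) (sym (F-% l x∈K)))

  K-pow : ∀ k {x} → K x → K (pow x k)
  K-pow k {x} x∈K = begin
    pow (pow x k) (q ℕ.^ t)   ≈⟨ pow-* x (q ℕ.^ t) k ⟨
    pow x (q ℕ.^ t ℕ.* k)     ≈⟨ pow-congʳ x (ℕ.*-comm (q ℕ.^ t) k) ⟩
    pow x (k ℕ.* q ℕ.^ t)     ≈⟨ pow-* x k (q ℕ.^ t) ⟩
    pow (pow x (q ℕ.^ t)) k   ≈⟨ pow-cong k x∈K ⟩
    pow x k                   ∎

  normExponent : ℕ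
  normExponent = geometricSum (q ℕ.^ t) t'

  order≡ : q ℕ.^ n ≡ (q ℕ.^ t) ℕ.^ t'
  order≡ = ≡.trans (≡.cong (q ℕ.^_) n≡tt') (≡.sym (ℕ.^-*-assoc q t t'))

  normExponent-equation : suc (normExponent ℕ.* q ℕ.^ t) ≡ normExponent ℕ.+ q ℕ.^ n
  normExponent-equation = ≡.trans (geometricSum-closed (q ℕ.^ t) t') (≡.cong (normExponent ℕ.+_) (≡.sym order≡))

  normExponent>0 : 0 < normExponent
  normExponent>0 = positive 1≤t'
    where
    positive : ∀ {j} → 1 ≤ j → 0 < geometricSum (q ℕ.^ t) j
    positive {suc j} _ = s≤s z≤n

  -- With G the norm exponent, G qᵗ = (G - 1) + qⁿ. Since x^(qⁿ) = x, raising x^G to the power qᵗ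
  -- gives x^(G-1) x = x^G.
  K-norm : ∀ x → K (pow x normExponent)
  K-norm x = fixed normExponent>0 normExponent-equation
    where
    fixed : ∀ {m} → 0 < m → suc (m ℕ.* q ℕ.^ t) ≡ m ℕ.+ q ℕ.^ n → K (pow x m)
    fixed {suc m} _ eq = begin
      pow (pow x (suc m)) (q ℕ.^ t)   ≈⟨ pow-* x (q ℕ.^ t) (suc m) ⟨
      pow x (q ℕ.^ t ℕ.* suc m)       ≈⟨ pow-congʳ x (≡.trans (ℕ.*-comm (q ℕ.^ t) (suc m)) (ℕ.suc-injective eq)) ⟩
      pow x (m ℕ.+ q ℕ.^ n)           ≈⟨ pow-+ x m (q ℕ.^ n) ⟩
      pow x m * pow x (q ℕ.^ n)       ≈⟨ *-congˡ (fermat x) ⟩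
      pow x m * x                     ≈⟨ *-comm _ _ ⟩
      x * pow x m                     ∎

  normExponent-bound : ∀ {e} → e < t → normExponent ℕ.* q ℕ.^ e < q ℕ.^ n
  normExponent-bound {e} e<t = ≡.subst (normExponent ℕ.* q ℕ.^ e <_) (≡.sym order≡)
    (geometricSum-bound t' (primePower>1 primePower) e<t)

  -- Linear independence of the Frobenius powers on K.

  -- The list (e , c) ∷ … stands for the linearized polynomial Σ c x^(q^e).
  Linearized : Set c
  Linearized = List (ℕ × Carrier)

  evalLin : Linearized → Carrier → Carrier
  evalLin []             x = 0#
  evalLin ((e , a) ∷ as) x = a * F e x + evalLin as x

  -- Exponents may repeat in the list, so all contributions to `k` are added up.
  coefficient : Linearized → ℕ → Carrier
  coefficient []             k = 0#
  coefficient ((e , a) ∷ as) k = monomial e a k + coefficient as k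

  -- Composing with the norm x ↦ x^normExponent of L over K turns a relation on K into a
  -- polynomial of degree < |L| that vanishes on L.
  independent : ∀ as → All (λ { (e , _) → e < t }) as → (∀ x → K x → evalLin as x ≈ 0#) →
                ∀ k → k < t → coefficient as k ≈ 0#
  independent as as<t as≈0 k k<t = begin
    coefficient as k    ≈⟨ coefficient-composed as k ⟨
    composed as (h k)   ≈⟨ vanishing⇒zero (composed as)
                             (λ x → trans (eval-composed as as<t x) (as≈0 _ (K-norm x)))
                             (h k) (normExponent-bound k<t) ⟩
    0#                  ∎
    where
    h : ℕ → ℕ
    h e = normExponent ℕ.* q ℕ.^ e
    instance
      _ = ℕ.>-nonZero normExponent>0
    h-injective : ∀ {i j} → h i ≡ h j → i ≡ j
    h-injective {i} {j} eq = ^-injective (ℕ.*-cancelˡ-≡ (q ℕ.^ i) (q ℕ.^ j) normExponent eq)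
      where
      ^-injective : ∀ {i j} → q ℕ.^ i ≡ q ℕ.^ j → i ≡ j
      ^-injective {i} {j} eq with ℕ.<-cmp i j
      ... | tri< i<j _ _ = contradiction eq (ℕ.<⇒≢ (ℕ.^-monoʳ-< q (primePower>1 primePower) i<j))
      ... | tri≈ _ i≡j _ = i≡j
      ... | tri> _ _ j<i = contradiction (≡.sym eq) (ℕ.<⇒≢ (ℕ.^-monoʳ-< q (primePower>1 primePower) j<i))
    composed : Linearized → ℕ → Carrier
    composed []             k = 0#
    composed ((e , a) ∷ as) k = monomial (h e) a k + composed as k
    coefficient-composed : ∀ as k → composed as (h k) ≈ coefficient as k
    coefficient-composed []             k = refl
    coefficient-composed ((e , a) ∷ as) k =
      +-cong (reflexive (monomial-reindex h h-injective e a k)) (coefficient-composed as k)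
    eval-composed : ∀ as → All (λ { (e , _) → e < t }) as → ∀ x →
                    eval (q ℕ.^ n) (composed as) x ≈ evalLin as (pow x normExponent)
    eval-composed []             []           x = eval-0 (q ℕ.^ n) x
    eval-composed ((e , a) ∷ as) (e<t ∷ as<t) x = begin
      eval (q ℕ.^ n) (composed ((e , a) ∷ as)) x
        ≈⟨ eval-+ (q ℕ.^ n) (monomial (h e) a) (composed as) x ⟩
      eval (q ℕ.^ n) (monomial (h e) a) x + eval (q ℕ.^ n) (composed as) x
        ≈⟨ +-cong (eval-monomial (q ℕ.^ n) (h e) a x (normExponent-bound e<t)) (eval-composed as as<t x) ⟩
      a * pow x (h e) + evalLin as (pow x normExponent)
        ≈⟨ +-congʳ (*-congˡ (trans (pow-congʳ x (ℕ.*-comm normExponent (q ℕ.^ e))) (pow-* x (q ℕ.^ e) normExponent))) ⟩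
      a * F e (pow x normExponent) + evalLin as (pow x normExponent) ∎

  -- Semilinear maps and their kernels.

  record Semilinear (s : ℕ) (f : Carrier → Carrier) : Set (c ⊔ ℓ) where
    field
      cong       : ∀ {x y} → x ≈ y → f x ≈ f y
      additive   : ∀ x y → f (x + y) ≈ f x + f y
      semilinear : ∀ a x → K a → f (a * x) ≈ F s a * f x

  sumFin-cong : ∀ m {v w : Fin m → Carrier} → (∀ i → v i ≈ w i) → sumFin m v ≈ sumFin m w
  sumFin-cong zero    v≈w = refl
  sumFin-cong (suc m) v≈w = +-cong (v≈w Fin.zero) (sumFin-cong m (v≈w ∘ Fin.suc))

  sumFin-+ : ∀ m (v w : Fin m → Carrier) → sumFin m (λ i → v i + w i) ≈ sumFin m v + sumFin m w
  sumFin-+ zero    v w = sym (+-identityˡ 0#)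
  sumFin-+ (suc m) v w = trans (+-congˡ (sumFin-+ m (v ∘ Fin.suc) (w ∘ Fin.suc)))
    (solve 4 (λ a b c d → (a :+ b) :+ (c :+ d) := (a :+ c) :+ (b :+ d)) refl _ _ _ _)

  sumFin-* : ∀ m a (v : Fin m → Carrier) → sumFin m (λ i → a * v i) ≈ a * sumFin m v
  sumFin-* zero    a v = sym (zeroʳ a)
  sumFin-* (suc m) a v = trans (+-congˡ (sumFin-* m a (v ∘ Fin.suc))) (sym (distribˡ a _ _))

  linPoly-semilinear : ∀ s a → Semilinear s (linPoly q t t' s a)
  linPoly-semilinear s a = record
    { cong       = λ x≈y → sumFin-cong t' (λ i → *-congˡ (F-cong (exponent i) x≈y))
    ; additive   = λ x y → trans
        (sumFin-cong t' (λ i → trans (*-congˡ (F-+ (exponent i) x y)) (distribˡ _ _ _)))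
        (sumFin-+ t' _ _)
    ; semilinear = λ b x b∈K → trans (sumFin-cong t' (term b x b∈K)) (sumFin-* t' (F s b) _)
    }
    where
    exponent : Fin t' → ℕ
    exponent i = toℕ i ℕ.* t ℕ.+ s
    term : ∀ b x → K b → ∀ i → a i * F (exponent i) (b * x) ≈ F s b * (a i * F (exponent i) x)
    term b x b∈K i = begin
      a i * F (exponent i) (b * x)                 ≈⟨ *-congˡ (F-* (exponent i) b x) ⟩
      a i * (F (exponent i) b * F (exponent i) x)  ≈⟨ *-congˡ (*-congʳ (F-∘ (toℕ i ℕ.* t) s b)) ⟩
      a i * (F (toℕ i ℕ.* t) (F s b) * F (exponent i) x) ≈⟨ *-congˡ (*-congʳ (F-multiple (toℕ i) (K-pow (q ℕ.^ s) b∈K))) ⟩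
      a i * (F s b * F (exponent i) x)             ≈⟨ solve 3 (λ a b c → a :* (b :* c) := b :* (a :* c)) refl _ _ _ ⟩
      F s b * (a i * F (exponent i) x)             ∎

  module _ {s f} (f-semilinear : Semilinear s f) where
    open Semilinear f-semilinear

    kernel-trivial⇒injective : (∀ z → f z ≈ 0# → z ≈ 0#) → ∀ {x y} → f x ≈ f y → x ≈ y
    kernel-trivial⇒injective kernel {x} {y} fx≈fy =
      x∙y⁻¹≈ε⇒x≈y x y (kernel (x - y) (+-cancelʳ (f y) _ _ (begin
        f (x - y) + f y    ≈⟨ additive (x - y) y ⟨
        f (x - y + y)      ≈⟨ cong (trans (+-assoc x (- y) y) (trans (+-congˡ (-‿inverseˡ y)) (+-identityʳ x))) ⟩
        f x                ≈⟨ fx≈fy ⟩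
        f y                ≈⟨ +-identityˡ _ ⟨
        0# + f y           ∎)))

    -- A zero z ≠ 0 of f makes f vanish on K z, so that scatteredness would give K = 𝔽_q.
    scattered⇒kernel-trivial : 1 < t → PartiallyScattered q t f → ∀ z → f z ≈ 0# → z ≈ 0#
    scattered⇒kernel-trivial 1<t scattered z fz≈0 with z ≈? 0#
    ... | yes z≈0 = z≈0
    ... | no  z≉0 = contradiction 1≈0 1≉0
      where
      f[wz]≈0 : ∀ w → K w → f (w * z) ≈ 0#
      f[wz]≈0 w w∈K = trans (semilinear w z w∈K) (trans (*-congˡ fz≈0) (zeroʳ _))
      K⊆F₁ : ∀ w → K w → F 1 w ≈ w
      K⊆F₁ w w∈K with w ≈? 0#
      ... | yes w≈0 = trans (F-cong 1 w≈0) (trans (pow-0# (q ℕ.^ 1) (ℕ.m^n>0 q 1)) (sym w≈0))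
      ... | no  w≉0 with w' , wz≈w'z , w'∈F₁ ← scattered (w * z) z (*-nonzero w≉0 z≉0) z≉0
                           (trans (trans (*-congʳ (f[wz]≈0 w w∈K)) (zeroˡ _))
                                  (sym (trans (*-congʳ fz≈0) (zeroˡ _))))
                           (w , refl , w∈K) =
        trans (F-cong 1 w≈w') (trans w'∈F₁ (sym w≈w'))
        where
        w≈w' : w ≈ w'
        w≈w' = *-cancel z≉0 (trans (*-comm z w) (trans wz≈w'z (*-comm w' z)))
      1≈0 : 1# ≈ 0#
      -- On K the polynomial x^q - x vanishes, although its exponents 1 and 0 are distinct and below
      -- t; its coefficient 1 at exponent 1 must then be 0.
      1≈0 = trans (sym (trans (+-congˡ (+-identityˡ 0#)) (+-identityʳ 1#)))
        (independent ((1 , 1#) ∷ (0 , - 1#) ∷ []) (1<t ∷ 1≤t ∷ []) (λ w w∈K → begin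
          1# * F 1 w + (- 1# * F 0 w + 0#)  ≈⟨ +-cong (*-identityˡ _) (+-identityʳ _) ⟩
          F 1 w + - 1# * F 0 w              ≈⟨ +-cong (K⊆F₁ w w∈K) (*-congˡ (F-0 w)) ⟩
          w + - 1# * w                      ≈⟨ +-congˡ (-‿distribˡ-* 1# w) ⟨
          w - 1# * w                        ≈⟨ +-congˡ (-‿cong (*-identityˡ w)) ⟩
          w - w                             ≈⟨ -‿inverseʳ w ⟩
          0#                                ∎) 1 1<t)

  -- Construction of weak equivalences.

  -- `h` is the map that `φ` induces on the parameters of the two graphs; its surjectivity makes the
  -- image of U_f all of U_g. Every equivalence constructed here is K-linear, so the field
  -- automorphism is the identity.
  linear⇒weaklyEquivalent : ∀ {f g} (φ : Pair → Pair) (h : Carrier → Carrier) →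
    (∀ {x y} → x ≈ y → g x ≈ g y) →
    (∀ u v → u ≈P v → φ u ≈P φ v) →
    (∀ u v → φ (u +P v) ≈P (φ u +P φ v)) →
    (∀ a u → K a → φ (a ·P u) ≈P (a ·P φ u)) →
    (∀ u v → φ u ≈P φ v → u ≈P v) →
    (∀ v → ∃[ u ] (φ u ≈P v)) →
    (∀ x → φ (x , f x) ≈P (h x , g (h x))) → (∀ y → ∃[ x ] (h x ≈ y)) →
    WeaklyEquivalent q t f g
  linear⇒weaklyEquivalent {f} {g} φ h g-cong φ-cong φ-+ φ-· φ-inj φ-surj φ-graph h-surj =
    φ , (φ-cong , φ-+ , ((λ x → x) , idSubAut , φ-·) , φ-inj , φ-surj) , into , onto
    where
    idSubAut : IsSubAut q t (λ x → x)
    idSubAut = (λ _ _ x≈y → x≈y) , (λ _ x∈K → x∈K) , (λ _ _ _ _ → refl) , (λ _ _ _ _ → refl) ,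
      refl , (λ _ _ _ _ x≈y → x≈y) , (λ y y∈K → y , y∈K , refl)
    transP : ∀ {u v w} → u ≈P v → v ≈P w → u ≈P w
    transP (a , b) (c , d) = trans a c , trans b d
    into : ∀ v → InGraph f v → InGraph g (φ v)
    into v (x , v≈x,fx) = h x , transP (φ-cong _ _ v≈x,fx) (φ-graph x)
    onto : ∀ w → InGraph g w → ∃[ v ] (InGraph f v × φ v ≈P w)
    onto w (y , w₁≈y , w₂≈gy) with x , hx≈y ← h-surj y =
      (x , f x) , (x , refl , refl) ,
      transP (φ-graph x) (trans hx≈y (sym w₁≈y) , trans (g-cong hx≈y) (sym w₂≈gy))

  module _ {s s' f g} (f-semilinear : Semilinear s f) (g-semilinear : Semilinear s' g) where
    private
      module f = Semilinear f-semilinear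
      module g = Semilinear g-semilinear

    -- When both Frobenius twists are trivial on K, g - f is K-linear. The shear by it is inverted
    -- by subtracting it again, whatever the kernels of f and g are.
    linear-difference⇒weaklyEquivalent : (∀ x → K x → F s x ≈ x) → (∀ x → K x → F s' x ≈ x) →
                                         WeaklyEquivalent q t f g
    linear-difference⇒weaklyEquivalent Fs≈id Fs'≈id =
      linear⇒weaklyEquivalent φ (λ x → x) g.cong
        (λ { (x , y) (x' , y') (x≈ , y≈) → x≈ , +-cong y≈ (d-cong x≈) })
        (λ { (x , y) (x' , y') → refl , trans (+-congˡ (d-+ x x'))
          (solve 4 (λ a b c d → (a :+ b) :+ (c :+ d) := (a :+ c) :+ (b :+ d)) refl y y' (d x) (d x')) })
        (λ { a (x , y) a∈K → refl , trans (+-congˡ (d-* a x a∈K)) (sym (distribˡ a y (d x))) })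
        (λ { (x , y) (x' , y') (x≈ , y≈) → x≈ ,
          +-cancelʳ (d x) y y' (trans y≈ (+-congˡ (d-cong (sym x≈)))) })
        (λ { (x , y) → (x , y - d x) , refl ,
          trans (+-assoc _ _ _) (trans (+-congˡ (-‿inverseˡ (d x))) (+-identityʳ y)) })
        (λ x → refl , trans (solve 3 (λ a b c → a :+ (b :+ c) := b :+ (a :+ c)) refl (f x) (g x) (- f x))
          (trans (+-congˡ (-‿inverseʳ (f x))) (+-identityʳ (g x))))
        (λ y → y , refl)
      where
      d : Carrier → Carrier
      d x = g x - f x
      φ : Pair → Pair
      φ (x , y) = x , y + d x
      d-cong : ∀ {x y} → x ≈ y → d x ≈ d y
      d-cong x≈y = +-cong (g.cong x≈y) (-‿cong (f.cong x≈y))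
      d-+ : ∀ x y → d (x + y) ≈ d x + d y
      d-+ x y = begin
        g (x + y) - f (x + y)              ≈⟨ +-cong (g.additive x y) (-‿cong (f.additive x y)) ⟩
        (g x + g y) - (f x + f y)          ≈⟨ +-congˡ (-‿+-comm (f x) (f y)) ⟨
        (g x + g y) + (- f x + - f y)      ≈⟨ solve 4 (λ a b c d → (a :+ b) :+ (c :+ d) := (a :+ c) :+ (b :+ d)) refl (g x) (g y) (- f x) (- f y) ⟩
        d x + d y                          ∎
      d-* : ∀ a x → K a → d (a * x) ≈ a * d x
      d-* a x a∈K = begin
        g (a * x) - f (a * x)              ≈⟨ +-cong (g.semilinear a x a∈K) (-‿cong (f.semilinear a x a∈K)) ⟩
        F s' a * g x - F s a * f x         ≈⟨ +-cong (*-congʳ (Fs'≈id a a∈K)) (-‿cong (*-congʳ (Fs≈id a a∈K))) ⟩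
        a * g x - a * f x                  ≈⟨ +-congˡ (-‿distribʳ-* a (f x)) ⟩
        a * g x + a * - f x                ≈⟨ distribˡ a _ _ ⟨
        a * d x                            ∎

    module _ (f-kernel : ∀ z → f z ≈ 0# → z ≈ 0#) (g-kernel : ∀ z → g z ≈ 0# → z ≈ 0#) where
      private
        f-inj = λ {x} {y} → kernel-trivial⇒injective f-semilinear f-kernel {x} {y}
        g-inj = λ {x} {y} → kernel-trivial⇒injective g-semilinear g-kernel {x} {y}
        f-surj = injective⇒surjective f f-inj
        g-surj = injective⇒surjective g g-inj

      -- f⁻¹ twists scalars of K by the inverse of `F s` and g twists them by `F s'`; the two
      -- cancel, which makes g ∘ f⁻¹ K-linear.
      congruent⇒weaklyEquivalent : (∀ x → K x → F s x ≈ F s' x) → WeaklyEquivalent q t f g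
      congruent⇒weaklyEquivalent Fs≈Fs' =
        linear⇒weaklyEquivalent φ (λ x → x) g.cong
          (λ { (x , y) (x' , y') (x≈ , y≈) → x≈ , g.cong (f⁻¹-cong y≈) })
          (λ { (x , y) (x' , y') → refl , trans (g.cong (f⁻¹-+ y y')) (g.additive _ _) })
          (λ { a (x , y) a∈K → refl , gf⁻¹-* a y a∈K })
          (λ { (x , y) (x' , y') (x≈ , y≈) → x≈ ,
            trans (sym (ff⁻¹ y)) (trans (f.cong (g-inj y≈)) (ff⁻¹ y')) })
          (λ { (x , y) → (x , f (proj₁ (g-surj y))) , refl ,
            trans (g.cong (f-inj (ff⁻¹ _))) (proj₂ (g-surj y)) })
          (λ x → refl , g.cong (f-inj (ff⁻¹ _)))
          (λ y → y , refl)
        where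
        f⁻¹ : Carrier → Carrier
        f⁻¹ y = proj₁ (f-surj y)
        ff⁻¹ : ∀ y → f (f⁻¹ y) ≈ y
        ff⁻¹ y = proj₂ (f-surj y)
        φ : Pair → Pair
        φ (x , y) = x , g (f⁻¹ y)
        f⁻¹-cong : ∀ {x y} → x ≈ y → f⁻¹ x ≈ f⁻¹ y
        f⁻¹-cong x≈y = f-inj (trans (ff⁻¹ _) (trans x≈y (sym (ff⁻¹ _))))
        f⁻¹-+ : ∀ x y → f⁻¹ (x + y) ≈ f⁻¹ x + f⁻¹ y
        f⁻¹-+ x y = f-inj (trans (ff⁻¹ _) (sym (trans (f.additive _ _) (+-cong (ff⁻¹ x) (ff⁻¹ y)))))
        gf⁻¹-* : ∀ a y → K a → g (f⁻¹ (a * y)) ≈ a * g (f⁻¹ y)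
        gf⁻¹-* a y a∈K = begin
          g (f⁻¹ (a * y))      ≈⟨ g.cong (f-inj (trans (ff⁻¹ _) (sym f[bf⁻¹y]≈ay))) ⟩
          g (b * f⁻¹ y)        ≈⟨ g.semilinear b _ b∈K ⟩
          F s' b * g (f⁻¹ y)   ≈⟨ *-congʳ (trans (sym (Fs≈Fs' b b∈K)) Fsb≈a) ⟩
          a * g (f⁻¹ y)        ∎
          where
          -- The preimage of `a` under `F s` on K: since s + s (t - 1) = s t, applying `F s` to it
          -- amounts to a multiple of t Frobenius steps.
          b = F (s ℕ.* ℕ.pred t) a
          b∈K : K b
          b∈K = K-pow (q ℕ.^ (s ℕ.* ℕ.pred t)) a∈K
          Fsb≈a : F s b ≈ a
          Fsb≈a = begin
            F s (F (s ℕ.* ℕ.pred t) a)      ≈⟨ F-∘ s (s ℕ.* ℕ.pred t) a ⟨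
            F (s ℕ.+ s ℕ.* ℕ.pred t) a      ≡⟨ ≡.cong (λ k → F k a) (ℕ.*-suc s (ℕ.pred t)) ⟨
            F (s ℕ.* suc (ℕ.pred t)) a      ≡⟨ ≡.cong (λ k → F (s ℕ.* k) a) (ℕ.suc-pred t) ⟩
            F (s ℕ.* t) a                   ≈⟨ F-multiple s a∈K ⟩
            a                               ∎
          f[bf⁻¹y]≈ay : f (b * f⁻¹ y) ≈ a * y
          f[bf⁻¹y]≈ay = trans (f.semilinear b _ b∈K) (*-cong Fsb≈a (ff⁻¹ y))

      -- Here the twists of f and g compose to the identity on K, so g ∘ f is K-linear. Swapping the
      -- coordinates makes f x the new parameter, so the surjectivity of f is what fills U_g.
      opposite⇒weaklyEquivalent : (∀ x → K x → F (s' ℕ.+ s) x ≈ x) → WeaklyEquivalent q t f g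
      opposite⇒weaklyEquivalent Fs'+s≈id =
        linear⇒weaklyEquivalent φ f g.cong
          (λ { (x , y) (x' , y') (x≈ , y≈) → y≈ , g.cong (f.cong x≈) })
          (λ { (x , y) (x' , y') → refl , trans (g.cong (f.additive x x')) (g.additive _ _) })
          (λ { a (x , y) a∈K → refl , gf-* a x a∈K })
          (λ { (x , y) (x' , y') (y≈ , x≈) → f-inj (g-inj x≈) , y≈ })
          (λ { (x , y) → (proj₁ (f-surj (proj₁ (g-surj y))) , x) , refl ,
            trans (g.cong (proj₂ (f-surj _))) (proj₂ (g-surj y)) })
          (λ x → refl , refl)
          f-surj
        where
        φ : Pair → Pair
        φ (x , y) = y , g (f x)
        gf-* : ∀ a x → K a → g (f (a * x)) ≈ a * g (f x)
        gf-* a x a∈K = begin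
          g (f (a * x))             ≈⟨ g.cong (f.semilinear a x a∈K) ⟩
          g (F s a * f x)           ≈⟨ g.semilinear _ _ (K-pow (q ℕ.^ s) a∈K) ⟩
          F s' (F s a) * g (f x)    ≈⟨ *-congʳ (trans (sym (F-∘ s' s a)) (Fs'+s≈id a a∈K)) ⟩
          a * g (f x)               ∎

    -- The obstruction when the exponents are distinct.

    -- Write φ (x , 0) = (A , C) and φ (0 , f x) = (B , D) for x = 1. Applying φ to the points
    -- (a x , f (a x)) of U_f, a ∈ K, gives b C + F s b D = F s' b g(A) + F (s' + s) b g(B) for
    -- all b = σ a in K.
    distinct-exponents⇒¬weaklyEquivalent :
      (∀ z → g z ≈ 0# → z ≈ 0#) → 0 ≢ s % t → 0 ≢ s' % t → 0 ≢ (s' ℕ.+ s) % t →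
      s % t ≢ s' % t → s' % t ≢ (s' ℕ.+ s) % t → ¬ WeaklyEquivalent q t f g
    distinct-exponents⇒¬weaklyEquivalent g-kernel 0≢s 0≢s' 0≢s'+s s≢s' s'≢s'+s
      (φ , (φ-cong , φ-+ , (σ , (σ-cong , σ-K , _ , σ-* , σ-1 , _ , σ-surj) , φ-·) , φ-inj , _) , into , _) =
      1≉0 (proj₁ (φ-inj _ _ (trans A≈0 (sym (proj₁ φ0≈0)) , trans C≈0 (sym (proj₂ φ0≈0)))))
      where
      A = proj₁ (φ (1# , 0#))
      C = proj₂ (φ (1# , 0#))
      B = proj₁ (φ (0# , f 1#))
      D = proj₂ (φ (0# , f 1#))

      φ0≈0 : φ (0# , 0#) ≈P (0# , 0#)
      φ0≈0 = idempotent⇒0 (proj₁ φ0+φ0≈φ0) , idempotent⇒0 (proj₂ φ0+φ0≈φ0)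
        where
        idempotent⇒0 : ∀ {x} → x ≈ x + x → x ≈ 0#
        idempotent⇒0 {x} x≈x+x = sym (+-cancelˡ x _ _ (trans (+-identityʳ x) x≈x+x))
        0+0≈0 : (0# , 0#) ≈P ((0# , 0#) +P (0# , 0#))
        0+0≈0 = sym (+-identityˡ 0#) , sym (+-identityˡ 0#)
        φ0+φ0≈φ0 : φ (0# , 0#) ≈P (φ (0# , 0#) +P φ (0# , 0#))
        φ0+φ0≈φ0 = trans (proj₁ (φ-cong _ _ 0+0≈0)) (proj₁ (φ-+ _ _)) ,
                   trans (proj₂ (φ-cong _ _ 0+0≈0)) (proj₂ (φ-+ _ _))

      σ-pow : ∀ k {a} → K a → σ (pow a k) ≈ pow (σ a) k
      σ-pow zero    a∈K = σ-1
      σ-pow (suc k) a∈K = trans (σ-* _ _ a∈K (K-pow k a∈K)) (*-congˡ (σ-pow k a∈K))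

      relation : ∀ b → K b → b * C + F s b * D ≈ F s' b * g A + F (s' ℕ.+ s) b * g B
      -- Parametrizing by b = σ a eliminates the unknown automorphism: σ commutes with powers, so σ
      -- (F s a) = F s b.
      relation b b∈K with a , a∈K , σa≈b ← σ-surj b b∈K = begin
        b * C + F s b * D                            ≈⟨ proj₂ φ-split ⟨
        proj₂ (φ (a * 1# , f (a * 1#)))              ≈⟨ proj₂ (proj₂ graph) ⟩
        g (proj₁ graph)                              ≈⟨ g.cong (trans (sym (proj₁ (proj₂ graph))) (proj₁ φ-split)) ⟩
        g (b * A + F s b * B)                        ≈⟨ g.additive _ _ ⟩
        g (b * A) + g (F s b * B)                    ≈⟨ +-cong (g.semilinear b A b∈K) (g.semilinear _ B (K-pow (q ℕ.^ s) b∈K)) ⟩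
        F s' b * g A + F s' (F s b) * g B            ≈⟨ +-congˡ (*-congʳ (F-∘ s' s b)) ⟨
        F s' b * g A + F (s' ℕ.+ s) b * g B          ∎
        where
        graph : InGraph g (φ (a * 1# , f (a * 1#)))
        graph = into _ (a * 1# , refl , refl)
        u v : Pair
        u = a ·P (1# , 0#)
        v = F s a ·P (0# , f 1#)
        split : (a * 1# , f (a * 1#)) ≈P (u +P v)
        split = trans (sym (+-identityʳ _)) (+-congˡ (sym (zeroʳ _))) ,
                trans (f.semilinear a 1# a∈K) (trans (sym (+-identityˡ _)) (+-congʳ (sym (zeroʳ _))))
        σF≈ : σ (F s a) ≈ F s b
        σF≈ = trans (σ-pow (q ℕ.^ s) a∈K) (F-cong s σa≈b)
        φu = φ-· a (1# , 0#) a∈K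
        φv = φ-· (F s a) (0# , f 1#) (K-pow (q ℕ.^ s) a∈K)
        φ-split : φ (a * 1# , f (a * 1#)) ≈P ((b * A + F s b * B) , (b * C + F s b * D))
        φ-split =
          trans (proj₁ (φ-cong _ _ split)) (trans (proj₁ (φ-+ u v))
            (+-cong (trans (proj₁ φu) (*-congʳ σa≈b)) (trans (proj₁ φv) (*-congʳ σF≈)))) ,
          trans (proj₂ (φ-cong _ _ split)) (trans (proj₂ (φ-+ u v))
            (+-cong (trans (proj₂ φu) (*-congʳ σa≈b)) (trans (proj₂ φv) (*-congʳ σF≈))))

      terms : Linearized
      -- Independence needs exponents below t; reducing them mod t does not change the values on K.
      terms = (0 , C) ∷ (s % t , D) ∷ (s' % t , - g A) ∷ ((s' ℕ.+ s) % t , - g B) ∷ []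

      terms-vanish : ∀ b → K b → evalLin terms b ≈ 0#
      terms-vanish b b∈K = begin
        C * F 0 b + (D * F (s % t) b + (- g A * F (s' % t) b + (- g B * F ((s' ℕ.+ s) % t) b + 0#)))
          ≈⟨ +-cong (*-congˡ (F-0 b)) (+-cong (*-congˡ (sym (F-% s b∈K))) (+-cong (*-congˡ (sym (F-% s' b∈K)))
               (+-congʳ (*-congˡ (sym (F-% (s' ℕ.+ s) b∈K)))))) ⟩
        C * b + (D * F s b + (- g A * F s' b + (- g B * F (s' ℕ.+ s) b + 0#)))
          ≈⟨ solve 8 (λ c b d x a y e z → c :* b :+ (d :* x :+ (a :* y :+ (e :* z :+ con 0)))
                := (b :* c :+ x :* d) :+ (a :* y :+ e :* z)) refl C b D (F s b) (- g A) (F s' b) (- g B) (F (s' ℕ.+ s) b) ⟩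
        (b * C + F s b * D) + (- g A * F s' b + - g B * F (s' ℕ.+ s) b)
          ≈⟨ +-congʳ (relation b b∈K) ⟩
        (F s' b * g A + F (s' ℕ.+ s) b * g B) + (- g A * F s' b + - g B * F (s' ℕ.+ s) b)
          ≈⟨ solve 6 (λ a y e z a' e' → (y :* a :+ z :* e) :+ (a' :* y :+ e' :* z)
                := (a :+ a') :* y :+ (e :+ e') :* z) refl (g A) (F s' b) (g B) (F (s' ℕ.+ s) b) (- g A) (- g B) ⟩
        (g A - g A) * F s' b + (g B - g B) * F (s' ℕ.+ s) b
          ≈⟨ +-cong (*-congʳ (-‿inverseʳ _)) (*-congʳ (-‿inverseʳ _)) ⟩
        0# * F s' b + 0# * F (s' ℕ.+ s) b
          ≈⟨ solve 2 (λ x y → con 0 :* x :+ con 0 :* y := con 0) refl _ _ ⟩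
        0# ∎

      terms-coefficient : ∀ k → k < t → coefficient terms k ≈ 0#
      terms-coefficient = independent terms
        (1≤t ∷ m%n<n s t ∷ m%n<n s' t ∷ m%n<n (s' ℕ.+ s) t ∷ []) terms-vanish

      -- Only C sits at exponent 0. If s' + s ≡ 0, the term with g(B) would join it, leaving C =
      -- g(B), as for the equivalence (x , y) ↦ (y , g (f x)).
      C≈0 : C ≈ 0#
      C≈0 = begin
        C                              ≈⟨ solve 1 (λ c → c := c :+ (con 0 :+ (con 0 :+ (con 0 :+ con 0)))) refl C ⟩
        C + (0# + (0# + (0# + 0#)))    ≡⟨ ≡.cong (C +_) (≡.cong₂ _+_ (monomial-off D (0≢s ∘ ≡.sym))
                                            (≡.cong₂ _+_ (monomial-off (- g A) (0≢s' ∘ ≡.sym))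
                                               (≡.cong (_+ 0#) (monomial-off (- g B) (0≢s'+s ∘ ≡.sym))))) ⟨
        coefficient terms 0            ≈⟨ terms-coefficient 0 1≤t ⟩
        0#                             ∎

      -- Only g(A) sits at exponent s'. If s ≡ s', D would join it, leaving D = g(A), as for the
      -- equivalence (x , y) ↦ (x , g (f⁻¹ y)).
      A≈0 : A ≈ 0#
      A≈0 = g-kernel A (begin
        g A                            ≈⟨ +-identityʳ _ ⟨
        g A + 0#                       ≈⟨ +-congˡ -gA≈0 ⟨
        g A - g A                      ≈⟨ -‿inverseʳ (g A) ⟩
        0#                             ∎)
        where
        -gA≈0 : - g A ≈ 0#
        -gA≈0 = begin
          - g A                           ≈⟨ solve 1 (λ a → a := con 0 :+ (con 0 :+ (a :+ (con 0 :+ con 0)))) refl (- g A) ⟩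
          0# + (0# + (- g A + (0# + 0#))) ≡⟨ ≡.cong₂ _+_ (monomial-off C 0≢s') (≡.cong₂ _+_ (monomial-off D s≢s')
                                               (≡.cong₂ _+_ (monomial-diag (s' % t) (- g A))
                                                  (≡.cong (_+ 0#) (monomial-off (- g B) (s'≢s'+s ∘ ≡.sym))))) ⟨
          coefficient terms (s' % t)      ≈⟨ terms-coefficient (s' % t) (m%n<n s' t) ⟩
          0#                              ∎

-- Case distinction on t and on the residues of s and s'.

open import Data.Nat using (ℕ; _*_; _≤_)
open import Data.Nat.GCD using (gcd)
open import Data.Fin using (Fin)
open import Data.Integer using (+_; _-_; _+_)
open import Data.Integer.Divisibility using (_∣_)
open import Data.Sum using (_⊎_)
open import Relation.Binary.PropositionalEquality using (_≡_)
open import Function.Bundles using (_⇔_)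

theorem8p2 : ∀ {c ℓ} (R : CommutativeRing c ℓ) → FF.IsField R →
    (q n t t' s s' : ℕ) → IsPrimePower q → FF.HasCard R (q Data.Nat.^ n) →
    n ≡ t * t' → 1 ≤ t → 1 ≤ t' → gcd s t ≡ 1 → gcd s' t ≡ 1 →
    (a b : Fin t' → CommutativeRing.Carrier R) →
    FF.PartiallyScattered R q t (FF.linPoly R q t t' s a) →
    FF.PartiallyScattered R q t (FF.linPoly R q t t' s' b) →
    (FF.WeaklyEquivalent R q t (FF.linPoly R q t t' s a) (FF.linPoly R q t t' s' b)
    ⇔ ((+ t ∣ (+ s - + s')) ⊎ (+ t ∣ (+ s + + s'))))
theorem8p2 R isField q n t t' s s' primePower card n≡tt' 1≤t 1≤t' gcd[s,t]≡1 gcd[s',t]≡1 a b f-scattered g-scattered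
  with t ℕ.≟ 1
... | yes t≡1 = mk⇔
  (λ _ → inj₁ (≡.subst (ℕ._∣ _) (≡.sym t≡1) (ℕ.1∣ _)))
  (λ _ → linear-difference⇒weaklyEquivalent (linPoly-semilinear s a) (linPoly-semilinear s' b)
           (λ _ → F-∣ (t∣ s)) (λ _ → F-∣ (t∣ s')))
  where
  open Frobenius R isField primePower card n≡tt' 1≤t 1≤t'
  t∣ : ∀ k → t ℕ.∣ k
  t∣ k = ≡.subst (ℕ._∣ k) (≡.sym t≡1) (ℕ.1∣ k)
... | no  t≢1 = mk⇔ to from
  where
  open Frobenius R isField primePower card n≡tt' 1≤t 1≤t'
  open FF R
  f-semilinear = linPoly-semilinear s a
  g-semilinear = linPoly-semilinear s' b
  1<t : 1 < t
  1<t = ℕ.≤∧≢⇒< 1≤t (t≢1 ∘ ≡.sym)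
  f-kernel = scattered⇒kernel-trivial f-semilinear 1<t f-scattered
  g-kernel = scattered⇒kernel-trivial g-semilinear 1<t g-scattered

  coprime⇒∤ : ∀ {k} → gcd k t ≡ 1 → ¬ (t ℕ.∣ k)
  coprime⇒∤ gcd≡1 t∣k = t≢1 (ℕ.∣1⇒≡1 (≡.subst (t ℕ.∣_) gcd≡1 (gcd-greatest t∣k ℕ.∣-refl)))
  ∤⇒0≢% : ∀ {k} → ¬ (t ℕ.∣ k) → 0 ≢ k % t
  ∤⇒0≢% {k} t∤k 0≡k%t = t∤k (ℕ.m%n≡0⇒n∣m k t (≡.sym 0≡k%t))

  to : WeaklyEquivalent q t (linPoly q t t' s a) (linPoly q t t' s' b) →
       (+ t ∣ (+ s - + s')) ⊎ (+ t ∣ (+ s + + s'))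
  to f∼g with t ℕ.∣? ℕ.∣ s - s' ∣ | t ℕ.∣? (s ℕ.+ s')
  ... | yes t∣s-s' | _          = inj₁ (≡.subst (t ℕ.∣_) (≡.sym (∣+m-+n∣≡∣m-n∣ s s')) t∣s-s')
  ... | no  _      | yes t∣s+s' = inj₂ t∣s+s'
  ... | no  t∤s-s' | no  t∤s+s' = contradiction f∼g
    (distinct-exponents⇒¬weaklyEquivalent f-semilinear g-semilinear g-kernel
      (∤⇒0≢% (coprime⇒∤ gcd[s,t]≡1)) (∤⇒0≢% (coprime⇒∤ gcd[s',t]≡1))
      (∤⇒0≢% (t∤s+s' ∘ ≡.subst (t ℕ.∣_) (ℕ.+-comm s' s)))
      (t∤s-s' ∘ %-≡⇒∣∣-∣ t s s')
      -- The congruence s' ≡ s' + s would mean that t divides s, which coprimality excludes for t >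
      -- 1.
      (λ eq → coprime⇒∤ gcd[s,t]≡1 (≡.subst (t ℕ.∣_) (ℕ.∣m-m+n∣≡n s' s) (%-≡⇒∣∣-∣ t s' (s' ℕ.+ s) eq))))

  from : (+ t ∣ (+ s - + s')) ⊎ (+ t ∣ (+ s + + s')) →
         WeaklyEquivalent q t (linPoly q t t' s a) (linPoly q t t' s' b)
  from (inj₁ t∣s-s') = congruent⇒weaklyEquivalent f-semilinear g-semilinear f-kernel g-kernel
    (λ _ → F-congruent (∣∣-∣⇒%-≡ t s s' (≡.subst (t ℕ.∣_) (∣+m-+n∣≡∣m-n∣ s s') t∣s-s')))
  from (inj₂ t∣s+s') = opposite⇒weaklyEquivalent f-semilinear g-semilinear f-kernel g-kernel
    (λ _ → F-∣ (≡.subst (t ℕ.∣_) (ℕ.+-comm s s') t∣s+s'))
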